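{- A triangle-free graph $G$ of order $10$ is $(3,1)$-critical if and only if it is isomorphic to $G_5$.
   Context: Graphs are finite, undirected, with no loops or multiple edges. The order of a graph is its number of vertices. $\Delta(G)$ is the maximum degree and $G[U]$ is the subgraph induced on $U$. For a nonnegative integer $k$, a set $U\subseteq V(G)$ is $k$-independent if $\Delta(G[U])\le k$. $G$ is $(m,k)$-colourable if $V(G)$ can be partitioned into $m$ (possibly empty) $k$-independent sets. The $k$-defective chromatic number $\chi_k(G)$ is the least positive integer $m$ for which $G$ is $(m,k)$-colourable. A graph $G$ is $(m,k)$-critical if $\chi_k(G)=m$ and $\chi_k(G-u)<m$ for every vertex $u\in V(G)$. $G_5$ is the graph with the 10 vertices $u,v,u_1,u_2,u_3,u_4,u_5,z_1,z_2,z$ and exactly the following edges: each of $u,v$ is adjacent to each of $u_1,u_2,u_3,u_4,u_5$; $z$ is adjacent to $u_1,u_2,z_1,z_2$; $z_1$ is adjacent to $u_3,u_4$; $z_2$ is adjacent to $u_3,u_5$. -}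

module Defs where

open import Data.Bool.Base using (Bool; false; T; _∨_)
open import Data.Bool.Properties as Bool using (∨-comm)
open import Data.Fin.Base using (Fin; zero; suc)
open import Data.Fin.Patterns using (0F; 1F; 2F; 3F; 4F; 5F; 6F; 7F; 8F; 9F)
open import Data.Fin.Permutation using (Permutation; _⟨$⟩ʳ_)
open import Data.Fin.Properties as Fin using (all?)
open import Data.Fin.Subset using (Subset; inside; outside; _∈_; ∣_∣; ∁; ⁅_⁆)
open import Data.List.Base using (List; []; _∷_; map; allFin)
open import Data.List.Extrema.Nat using (max)
open import Data.List.Membership.DecPropositional using (_∈?_)
open import Data.Nat.Base using (ℕ; _≤_; _<_)
open import Data.Product using (_×_; _,_; ∃; ∃!; ∃-syntax)
open import Data.Product.Properties using (≡-dec)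
open import Data.Vec.Base using ([]; _∷_; tabulate)
open import Relation.Binary.PropositionalEquality using (_≡_)
open import Relation.Nullary.Decidable using (does; from-yes)
open import Relation.Nullary.Negation using (¬_)

private
  variable
    m n : ℕ

-- Simple graphs of order n; the vertex set is Fin n.
record Graph (n : ℕ) : Set where
  field
    adj      : Fin n → Fin n → Bool
    adj-sym  : ∀ x y → adj x y ≡ adj y x
    loopless : ∀ x → adj x x ≡ false

  Adj : Fin n → Fin n → Set
  Adj x y = T (adj x y)

open Graph public

infix 4 _≅_

record _≅_ (G : Graph m) (H : Graph n) : Set where
  field
    bijection : Permutation m n
    preserves : ∀ x y → adj G x y ≡ adj H (bijection ⟨$⟩ʳ x) (bijection ⟨$⟩ʳ y)

TriangleFree : Graph n → Set
TriangleFree G = ¬ (∃[ x ] ∃[ y ] ∃[ z ] (Adj G x y × Adj G y z × Adj G x z))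

neighbourhood : Graph n → Fin n → Subset n
neighbourhood G x = tabulate (adj G x)

degree : Graph n → Fin n → ℕ
degree G x = ∣ neighbourhood G x ∣

-- The null graph gets Δ = 0, so the empty set is k-independent for every k.
Δ : Graph n → ℕ
Δ {n} G = max 0 (map (degree G) (allFin n))

-- The increasing enumeration of the elements of U.
element : (U : Subset n) → Fin ∣ U ∣ → Fin n
element (inside  ∷ U) zero    = zero
element (inside  ∷ U) (suc i) = suc (element U i)
element (outside ∷ U) i       = suc (element U i)

-- Induced subgraph, with the vertices in U renumbered as Fin ∣ U ∣.
_[_] : Graph n → (U : Subset n) → Graph ∣ U ∣
G [ U ] = record
  { adj      = λ i j → adj G (element U i) (element U j)
  ; adj-sym  = λ i j → adj-sym G (element U i) (element U j)
  ; loopless = λ i → loopless G (element U i)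
  }

_-ᵥ_ : Graph n → (x : Fin n) → Graph ∣ ∁ ⁅ x ⁆ ∣
G -ᵥ x = G [ ∁ ⁅ x ⁆ ]

Independent : ℕ → Graph n → Subset n → Set
Independent k G U = Δ (G [ U ]) ≤ k

-- Parts may be empty.
IsPartition : (Fin m → Subset n) → Set
IsPartition U = ∀ x → ∃! _≡_ (λ i → x ∈ U i)

Colourable : ℕ → ℕ → Graph n → Set
Colourable {n} m k G =
  ∃ λ (U : Fin m → Subset n) → IsPartition U × (∀ i → Independent k G (U i))

-- "χ k , G ≐ m" says that the k-defective chromatic number of G is m.
χ_,_≐_ : ℕ → Graph n → ℕ → Set
χ k , G ≐ m = 0 < m × Colourable m k G × (∀ l → 0 < l → Colourable l k G → m ≤ l)

Critical : ℕ → ℕ → Graph n → Set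
Critical m k G = (χ k , G ≐ m) × (∀ x → ∃[ l ] ((χ k , G -ᵥ x ≐ l) × l < m))

module G₅-Vertices where
  pattern u  = 0F
  pattern v  = 1F
  pattern u₁ = 2F
  pattern u₂ = 3F
  pattern u₃ = 4F
  pattern u₄ = 5F
  pattern u₅ = 6F
  pattern z₁ = 7F
  pattern z₂ = 8F
  pattern z  = 9F

G₅-edges : List (Fin 10 × Fin 10)
G₅-edges =
    (u , u₁) ∷ (u , u₂) ∷ (u , u₃) ∷ (u , u₄) ∷ (u , u₅)
  ∷ (v , u₁) ∷ (v , u₂) ∷ (v , u₃) ∷ (v , u₄) ∷ (v , u₅)
  ∷ (z , u₁) ∷ (z , u₂) ∷ (z , z₁) ∷ (z , z₂)
  ∷ (z₁ , u₃) ∷ (z₁ , u₄)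
  ∷ (z₂ , u₃) ∷ (z₂ , u₅)
  ∷ []
  where open G₅-Vertices

G₅ : Graph 10
G₅ = record
  { adj      = λ x y → edge x y ∨ edge y x
  ; adj-sym  = λ x y → ∨-comm (edge x y) (edge y x)
  ; loopless = from-yes (all? λ x → (edge x x ∨ edge x x) Bool.≟ false)
  }
  where
  edge : Fin 10 → Fin 10 → Bool
  edge x y = does (_∈?_ (≡-dec Fin._≟_ Fin._≟_) (x , y) G₅-edges)

{-# OPTIONS --safe #-}

-- Call a graph minimal if it has no 2-colouring of defect at most 1 but all its
-- vertex-deleted subgraphs do.  By Lovász's theorem a minimal graph has a vertex
-- of degree at least 4, so up to isomorphism it contains the star on 0, 1, 2, 3, 4
-- with centre 0.  A case distinction on the remaining pairs of vertices then ends,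
-- in every case, with a 2-colouring of defect 1, with one of the four triangle-free
-- graphs of order 9 that have no such colouring, with G₅, or with an isomorphic
-- copy of a situation settled before.
module Submission where

open import Defs
open import Data.Bool.Base using (Bool; true; false; T; _∧_; if_then_else_)
open import Data.Bool.Properties as Bool using (T-≡; T-∧)
open import Data.Fin.Base
  using (Fin; zero; suc; toℕ; fromℕ; inject₁; inject≤; opposite; punchIn; punchOut)
open import Data.Fin.Patterns using (0F; 1F; 2F; 3F; 4F; 5F; 6F; 7F; 8F; 9F)
open import Data.Fin.Permutation as Perm
  using (Permutation; Permutation′; _⟨$⟩ʳ_; _∘ₚ_; inverseʳ; transpose)
open import Data.Fin.Properties
  using (_≟_; all?; any?; fromℕ≢inject₁; inject₁-injective; inject≤-injective;
         punchIn-punchOut; punchInᵢ≢i; punchOut-injective; suc-injective)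
open import Data.Fin.Subset using (Subset; inside; outside; _∈_; ∣_∣; ∁; ⁅_⁆)
open import Data.Fin.Subset.Properties using (_∈?_; x∈⁅x⁆; x∈∁p⇒x∉p; x∉p⇒x∈∁p; x≢y⇒x∉⁅y⁆)
open import Data.List.Base using (List; []; _∷_; allFin; foldr; map)
open import Data.List.Extrema.Nat using (max; max≤v⁺; xs≤max)
open import Data.List.Membership.Propositional.Properties using (∈-allFin)
open import Data.List.Relation.Unary.All as All using (All; []; _∷_)
import Data.List.Relation.Unary.All.Properties as All
open import Data.Maybe as Maybe using (Maybe; just; nothing; _<∣>_; _>>=_; to-witness-T)
open import Data.Maybe.Properties as Maybe using (just-injective)
open import Data.Maybe.Relation.Unary.All as MaybeAll using ()
open import Data.Nat.Base using (ℕ; zero; suc; _+_; _^_; _≤_; _<_; z≤n; s≤s; NonZero)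
open import Data.Nat.DivMod using (_/_; _mod_)
open import Data.Nat.Induction using (<-wellFounded)
import Data.Nat.Properties as ℕ
open import Data.Product using (_×_; _,_; ∃; proj₁; proj₂; uncurry)
open import Data.Sum.Base using (_⊎_; inj₁; inj₂; [_,_])
open import Data.Vec.Base
  using (Vec; []; _∷_; here; there; lookup; tabulate; _[_]≔_; _[_]%=_)
open import Data.Vec.Functional using (updateAt)
open import Data.Vec.Functional.Properties using (updateAt-minimal; updateAt-updates)
open import Data.Vec.Properties
  using (lookup∘tabulate; lookup∘update; lookup∘update′; lookup∘updateAt; lookup∘updateAt′;
         lookup⇒[]=; []=⇒lookup)
open import Function.Base using (_∘_; id)
open import Function.Bundles using (_⇔_; mk⇔; Equivalence; Injection)
open import Function.Properties.Inverse using (↔⇒↣)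
open import Function.Definitions using (Injective)
open import Induction.WellFounded using (Acc; acc)
open import Level using (0ℓ)
open import Relation.Binary.PropositionalEquality hiding ([_])
open import Relation.Nullary.Decidable
  using (Dec; yes; no; does; isYes; map′; ¬?; T?; _×-dec_; _⊎-dec_; _→-dec_;
         dec⇒maybe; from-yes; fromWitness; toWitness)
open import Relation.Nullary.Negation using (¬_; contradiction)
open import Relation.Unary using (Pred; Decidable; U; _⊆_)
open import Relation.Unary.Properties using (U?)

open import Algebra.Properties.CommutativeMonoid.Sum ℕ.+-0-commutativeMonoid
  using (sum; sum-cong-≗; sum-remove; ∑-distrib-+)
open Equivalence using (to; from)

-- The case tree is only a collection of hints: `check` turns each leaf into a proof of `Forces` or
-- fails, so nothing depends on how the tree was found. Three facts keep it small. A pair with a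
-- common neighbour is a non-edge, by triangle-freeness, and needs no branching. `Forces` is
-- compatible with relabelling, so a settled state absorbs its isomorphic copies. A state records
-- only decided pairs, so a settled set of edges disposes of every graph that contains it as a
-- spanning subgraph.
--
-- The graphs of order 9 are obstructions because of minimality: a graph that contains one of them
-- on the vertices other than `9` remains uncolourable after `9` is deleted.

private
  variable
    k l m n : ℕ

-- Enumerating the elements of a finite subset

element-∈ : (p : Subset n) (i : Fin ∣ p ∣) → element p i ∈ p
element-∈ (inside  ∷ p) zero    = here
element-∈ (inside  ∷ p) (suc i) = there (element-∈ p i)
element-∈ (outside ∷ p) i       = there (element-∈ p i)

element-injective : (p : Subset n) → Injective _≡_ _≡_ (element p)
element-injective (inside  ∷ p) {zero}  {zero}  _  = refl
element-injective (inside  ∷ p) {suc i} {suc j} eq =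
  cong suc (element-injective p (suc-injective eq))
element-injective (outside ∷ p) eq = element-injective p (suc-injective eq)

index : {p : Subset n} {x : Fin n} → x ∈ p → Fin ∣ p ∣
index {p = inside  ∷ p} here        = zero
index {p = inside  ∷ p} (there x∈p) = suc (index x∈p)
index {p = outside ∷ p} (there x∈p) = index x∈p

element-index : {p : Subset n} {x : Fin n} (x∈p : x ∈ p) → element p (index x∈p) ≡ x
element-index {p = inside  ∷ p} here        = refl
element-index {p = inside  ∷ p} (there x∈p) = cong suc (element-index x∈p)
element-index {p = outside ∷ p} (there x∈p) = cong suc (element-index x∈p)

∣p∣≤1⇒unique : {p : Subset n} → ∣ p ∣ ≤ 1 → ∀ {x y} → x ∈ p → y ∈ p → x ≡ y
∣p∣≤1⇒unique {p = p} ∣p∣≤1 x∈p y∈p = begin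
  _                      ≡⟨ element-index x∈p ⟨
  element p (index x∈p)  ≡⟨ cong (element p) (Fin≤1 ∣p∣≤1 (index x∈p) (index y∈p)) ⟩
  element p (index y∈p)  ≡⟨ element-index y∈p ⟩
  _                      ∎
  where
  open ≡-Reasoning
  Fin≤1 : k ≤ 1 → (i j : Fin k) → i ≡ j
  Fin≤1 (s≤s z≤n) zero zero = refl

unique⇒∣p∣≤1 : (p : Subset n) → (∀ {x y} → x ∈ p → y ∈ p → x ≡ y) → ∣ p ∣ ≤ 1
unique⇒∣p∣≤1 p unique = ℕ.≮⇒≥ λ 1<∣p∣ →
  contradiction
    (inject≤-injective 1<∣p∣ 1<∣p∣ zero (suc zero)
      (element-injective p (unique (element-∈ p _) (element-∈ p _))))
    λ ()

∈-tabulate : {f : Fin n → Bool} {x : Fin n} → x ∈ tabulate f ⇔ T (f x)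
∈-tabulate {f = f} {x} = mk⇔
  (λ x∈f → from T-≡ (trans (sym (lookup∘tabulate f x)) ([]=⇒lookup x∈f)))
  (λ fx → lookup⇒[]= x _ (trans (lookup∘tabulate f x) (to T-≡ fx)))

-- Independent parts versus colour functions

Δ≤1⇔ : (G : Graph n) →
  Δ G ≤ 1 ⇔ (∀ x y z → Adj G x y → Adj G x z → y ≡ z)
Δ≤1⇔ {n} G = mk⇔
  (λ Δ≤1 x _ _ xy xz → ∣p∣≤1⇒unique
    (ℕ.≤-trans (All.lookup (All.map⁻ (xs≤max 0 (map (degree G) (allFin n)))) (∈-allFin x)) Δ≤1)
    (from ∈-tabulate xy) (from ∈-tabulate xz))
  (λ unique → max≤v⁺ {xs = map (degree G) (allFin n)} z≤n (All.map⁺ (All.tabulate λ {x} _ →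
    unique⇒∣p∣≤1 (neighbourhood G x)
      λ y∈ z∈ → unique x _ _ (to ∈-tabulate y∈) (to ∈-tabulate z∈))))

-- Defect at most 1 on P: no path with three vertices in P is monochromatic.
OneDefective : Graph n → Pred (Fin n) 0ℓ → (Fin n → Fin m) → Set
OneDefective G P c = ∀ {x y z} → P x → P y → P z →
  Adj G x y → Adj G x z → c x ≡ c y → c x ≡ c z → y ≡ z

-- With the predicate `P`, deleting vertices is a restriction of the defect condition: the vertices
-- keep their names, whereas `G [ U ]` and `G -ᵥ x` renumber them.
Paintable : ℕ → (G : Graph n) → Pred (Fin n) 0ℓ → Set
Paintable {n} m G P = ∃ λ (c : Fin n → Fin m) → OneDefective G P c

independent⇔ : (G : Graph n) (p : Subset n) →
  Independent 1 G p ⇔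
    (∀ x y z → x ∈ p → y ∈ p → z ∈ p → Adj G x y → Adj G x z → y ≡ z)
independent⇔ G p = mk⇔
  (λ ind _ _ _ x∈p y∈p z∈p xy xz → begin
    _                      ≡⟨ element-index y∈p ⟨
    element p (index y∈p)  ≡⟨ cong (element p) (to (Δ≤1⇔ (G [ p ])) ind _ _ _
                                (restrict x∈p y∈p xy) (restrict x∈p z∈p xz)) ⟩
    element p (index z∈p)  ≡⟨ element-index z∈p ⟩
    _                      ∎)
  (λ unique → from (Δ≤1⇔ (G [ p ])) λ _ _ _ xy xz →
    element-injective p (unique _ _ _ (element-∈ p _) (element-∈ p _) (element-∈ p _) xy xz))
  where
  open ≡-Reasoning
  restrict : ∀ {x y} (x∈p : x ∈ p) (y∈p : y ∈ p) →
    Adj G x y → Adj (G [ p ]) (index x∈p) (index y∈p)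
  restrict x∈p y∈p = subst₂ (Adj G) (sym (element-index x∈p)) (sym (element-index y∈p))

colourable⇔paintable : (G : Graph n) → Colourable m 1 G ⇔ Paintable m G U
colourable⇔paintable {n} {m} G = mk⇔ paint classes
  where
  paint : Colourable m 1 G → Paintable m G U
  paint (p , part , ind) = c , λ {x} {y} {z} _ _ _ xy xz cx≡cy cx≡cz →
    to (independent⇔ G (p (c x))) (ind (c x)) x y z (∈p x)
      (subst (λ i → y ∈ p i) (sym cx≡cy) (∈p y))
      (subst (λ i → z ∈ p i) (sym cx≡cz) (∈p z)) xy xz
    where
    c : Fin n → Fin m
    c x = proj₁ (part x)
    ∈p : ∀ x → x ∈ p (c x)
    ∈p x = proj₁ (proj₂ (part x))
  classes : Paintable m G U → Colourable m 1 G
  classes (c , ok) = p ,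
    (λ x → c x , from ∈-tabulate (fromWitness refl) , ∈p⇒≡) ,
    (λ i → from (independent⇔ G (p i)) λ _ _ _ x∈ y∈ z∈ xy xz →
      ok _ _ _ xy xz (trans (∈p⇒≡ x∈) (sym (∈p⇒≡ y∈))) (trans (∈p⇒≡ x∈) (sym (∈p⇒≡ z∈))))
    where
    p : Fin m → Subset n
    p i = tabulate λ x → isYes (c x ≟ i)
    ∈p⇒≡ : ∀ {x i} → x ∈ p i → c x ≡ i
    ∈p⇒≡ {x} {i} x∈p = toWitness {a? = c x ≟ i} (to ∈-tabulate x∈p)

induced-paintable⇔ : (G : Graph n) (p : Subset n) →
  Paintable (suc m) (G [ p ]) U ⇔ Paintable (suc m) G (_∈ p)
induced-paintable⇔ {n} {m} G p = mk⇔ extend restrict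
  where
  extend : Paintable (suc m) (G [ p ]) U → Paintable (suc m) G (_∈ p)
  extend (c , ok) = d , λ {x} {y} {z} x∈ y∈ z∈ xy xz dx≡dy dx≡dz → begin
    y                     ≡⟨ element-index y∈ ⟨
    element p (index y∈)  ≡⟨ cong (element p) (ok _ _ _
                               (subst₂ (Adj G) (sym (element-index x∈)) (sym (element-index y∈)) xy)
                               (subst₂ (Adj G) (sym (element-index x∈)) (sym (element-index z∈)) xz)
                               (trans (sym (d-index x∈)) (trans dx≡dy (d-index y∈)))
                               (trans (sym (d-index x∈)) (trans dx≡dz (d-index z∈)))) ⟩
    element p (index z∈)  ≡⟨ element-index z∈ ⟩
    z                     ∎
    where
    open ≡-Reasoning
    d : Fin n → Fin (suc m)
    d x with x ∈? p
    ... | yes x∈p = c (index x∈p)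
    -- A default colour outside `p`, where the defect condition is never evaluated; it exists
    -- because the number of colours is a successor.
    ... | no _    = zero
    d-index : ∀ {x} (x∈p : x ∈ p) → d x ≡ c (index x∈p)
    d-index {x} x∈p with x ∈? p
    ... | yes x∈p′ = cong c (element-injective p (trans (element-index x∈p′) (sym (element-index x∈p))))
    ... | no  x∉p  = contradiction x∈p x∉p
  restrict : Paintable (suc m) G (_∈ p) → Paintable (suc m) (G [ p ]) U
  restrict (c , ok) = c ∘ element p , λ _ _ _ xy xz cx≡cy cx≡cz →
    element-injective p
      (ok (element-∈ p _) (element-∈ p _) (element-∈ p _) xy xz cx≡cy cx≡cz)

paintable-⊆ : (G : Graph n) {P Q : Pred (Fin n) 0ℓ} → P ⊆ Q → Paintable m G Q → Paintable m G P
paintable-⊆ G P⊆Q (c , ok) = c , λ Px Py Pz → ok (P⊆Q Px) (P⊆Q Py) (P⊆Q Pz)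

paintable-≤ : (G : Graph n) {P : Pred (Fin n) 0ℓ} → l ≤ m → Paintable l G P → Paintable m G P
paintable-≤ G l≤m (c , ok) = (λ x → inject≤ (c x) l≤m) , λ Px Py Pz xy xz cx≡cy cx≡cz →
  ok Px Py Pz xy xz (inject≤-injective l≤m l≤m _ _ cx≡cy) (inject≤-injective l≤m l≤m _ _ cx≡cz)

-- The new colour `fromℕ m` is worn by the vertex `w` alone, so its class has no edges.
paintable-suc : (G : Graph n) {x : Fin n} → Paintable m G (_≢ x) → Paintable (suc m) G U
paintable-suc {n} {m} G {w} (c , ok) = d , λ {x} {y} {z} _ _ _ → ok′ x y z
  where
  d : Fin n → Fin (suc m)
  d x with x ≟ w
  ... | yes _ = fromℕ m
  ... | no  _ = inject₁ (c x)
  ok′ : ∀ x y z → Adj G x y → Adj G x z → d x ≡ d y → d x ≡ d z → y ≡ z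
  ok′ x y z xy xz dx≡dy dx≡dz with x ≟ w | y ≟ w | z ≟ w
  ... | _       | yes refl | yes refl = refl
  ... | no  x≢w | no  y≢w  | no  z≢w  =
    ok x≢w y≢w z≢w xy xz (inject₁-injective dx≡dy) (inject₁-injective dx≡dz)
  ... | yes _   | no  _    | _        = contradiction dx≡dy fromℕ≢inject₁
  ... | yes _   | _        | no  _    = contradiction dx≡dz fromℕ≢inject₁
  ... | no  _   | yes _    | _        = contradiction (sym dx≡dy) fromℕ≢inject₁
  ... | no  _   | _        | yes _    = contradiction (sym dx≡dz) fromℕ≢inject₁

-ᵥ-paintable⇔ : (G : Graph n) (x : Fin n) →
  Colourable (suc m) 1 (G -ᵥ x) ⇔ Paintable (suc m) G (_≢ x)
-ᵥ-paintable⇔ G x = mk⇔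
  (paintable-⊆ G (λ y≢x → x∉p⇒x∈∁p (x≢y⇒x∉⁅y⁆ y≢x)) ∘
    to (induced-paintable⇔ G _) ∘ to (colourable⇔paintable (G -ᵥ x)))
  (from (colourable⇔paintable (G -ᵥ x)) ∘ from (induced-paintable⇔ G _) ∘
    paintable-⊆ G (λ { y∈∁x refl → x∈∁p⇒x∉p y∈∁x (x∈⁅x⁆ _) }))

-- Criticality in terms of two colours

Minimal : Graph n → Set
Minimal G = ¬ Paintable 2 G U × (∀ x → Paintable 2 G (_≢ x))

-- A vertex put back costs at most one new colour. Hence 2-paintability of `G` and of its
-- vertex-deleted subgraphs already determines the chromatic numbers 3 and 2.
critical⇔minimal : (G : Graph (suc n)) → Critical 3 1 G ⇔ Minimal G
critical⇔minimal G = mk⇔ minimal critical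
  where
  minimal : Critical 3 1 G → Minimal G
  minimal ((_ , _ , least) , smaller) =
    (λ paint → ℕ.<-irrefl refl (least 2 (s≤s z≤n) (from (colourable⇔paintable G) paint))) ,
    λ x → case (smaller x)
    where
    case : ∀ {x} → ∃ (λ l → (χ 1 , G -ᵥ x ≐ l) × l < 3) → Paintable 2 G (_≢ x)
    -- The value 0 is excluded by the positivity that is part of `χ_,_≐_`.
    case (suc l , (_ , col , _) , s≤s l<2) = paintable-≤ G l<2 (to (-ᵥ-paintable⇔ G _) col)
  critical : Minimal G → Critical 3 1 G
  critical (¬paint , paint) =
    ( s≤s z≤n
    , from (colourable⇔paintable G) (paintable-suc G (paint zero))
    , λ l _ col → ℕ.≰⇒> λ l≤2 → ¬paint (paintable-≤ G l≤2 (to (colourable⇔paintable G) col))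
    ) ,
    λ x → 2 ,
    ( s≤s z≤n
    , from (-ᵥ-paintable⇔ G x) (paint x)
    -- If one colour sufficed without `x`, a second one for `x` would paint all of `G`.
    , λ { (suc l) _ col → ℕ.≰⇒> λ { (s≤s z≤n) →
            ¬paint (paintable-suc G (to (-ᵥ-paintable⇔ G x) col)) } }
    ) , s≤s (s≤s (s≤s z≤n))

-- Invariance under isomorphism

≅-sym : {G : Graph m} {H : Graph n} → G ≅ H → H ≅ G
≅-sym {G = G} {H} G≅H = record
  { bijection = Perm.flip bijection
  ; preserves = λ x y → sym (trans (preserves _ _)
      (cong₂ (adj H) (inverseʳ bijection) (inverseʳ bijection)))
  } where open _≅_ G≅H

≅-trans : {G : Graph k} {H : Graph m} {I : Graph n} → G ≅ H → H ≅ I → G ≅ I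
≅-trans G≅H H≅I = record
  { bijection = _≅_.bijection G≅H ∘ₚ _≅_.bijection H≅I
  ; preserves = λ x y → trans (_≅_.preserves G≅H x y) (_≅_.preserves H≅I _ _)
  }

module _ {G : Graph m} {H : Graph n} (G≅H : G ≅ H) where
  open _≅_ G≅H renaming (bijection to π)

  π-injective : Injective _≡_ _≡_ (π ⟨$⟩ʳ_)
  π-injective = Injection.injective (↔⇒↣ π)

  adj-π : ∀ {x y} → Adj G x y → Adj H (π ⟨$⟩ʳ x) (π ⟨$⟩ʳ y)
  adj-π = subst T (preserves _ _)

  ≅-triangleFree : TriangleFree H → TriangleFree G
  ≅-triangleFree tf (x , y , z , xy , yz , xz) =
    tf (_ , _ , _ , adj-π xy , adj-π yz , adj-π xz)

  ≅-paintable : {P : Pred (Fin m) 0ℓ} {Q : Pred (Fin n) 0ℓ} →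
    (∀ {x} → P x → Q (π ⟨$⟩ʳ x)) → Paintable k H Q → Paintable k G P
  ≅-paintable P⊆Q (c , ok) = c ∘ (π ⟨$⟩ʳ_) , λ Px Py Pz xy xz cx≡cy cx≡cz →
    π-injective (ok (P⊆Q Px) (P⊆Q Py) (P⊆Q Pz)
      (adj-π xy) (adj-π xz) cx≡cy cx≡cz)

≅-minimal : {G : Graph m} {H : Graph n} → G ≅ H → Minimal H → Minimal G
≅-minimal G≅H (¬paint , paint) =
  ¬paint ∘ ≅-paintable (≅-sym G≅H) _ ,
  λ x → ≅-paintable G≅H (λ y≢x → y≢x ∘ π-injective G≅H) (paint (_≅_.bijection G≅H ⟨$⟩ʳ x))

-- Cuts and vertices of large degree

indicator : Bool → ℕ
indicator b = if b then 1 else 0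

∣tabulate∣ : (f : Fin n → Bool) → ∣ tabulate f ∣ ≡ sum (indicator ∘ f)
∣tabulate∣ {zero}  f = refl
∣tabulate∣ {suc n} f with f zero
... | true  = cong suc (∣tabulate∣ (f ∘ suc))
... | false = ∣tabulate∣ (f ∘ suc)

module MaxCut (G : Graph (suc n)) where

  Cut : Set
  Cut = Fin (suc n) → Fin 2

  uncut : Cut → Fin (suc n) → Fin (suc n) → Bool
  uncut c x y = adj G x y ∧ isYes (c x ≟ c y)

  defect : Cut → Fin (suc n) → ℕ
  defect c x = ∣ tabulate (uncut c x) ∣

  uncut-∈ : ∀ c {x y} → Adj G x y → c x ≡ c y → y ∈ tabulate (uncut c x)
  uncut-∈ c {x} xy cx≡cy =
    from (∈-tabulate {f = uncut c x}) (from T-∧ (xy , fromWitness cx≡cy))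

  uncut-sym : ∀ c x y → uncut c x y ≡ uncut c y x
  uncut-sym c x y rewrite adj-sym G x y with c x ≟ c y | c y ≟ c x
  ... | yes _  | yes _  = refl
  ... | no _   | no _   = refl
  ... | yes p  | no ¬p  = contradiction (sym p) ¬p
  ... | no ¬p  | yes p  = contradiction (sym p) ¬p

  defect-remove : ∀ c w →
    defect c w ≡ sum (λ i → indicator (uncut c w (punchIn w i)))
  defect-remove c w = begin
    defect c w                                   ≡⟨ ∣tabulate∣ (uncut c w) ⟩
    sum (indicator ∘ uncut c w)                  ≡⟨ sum-remove {i = w} (indicator ∘ uncut c w) ⟩
    indicator (uncut c w w) + sum (λ i → indicator (uncut c w (punchIn w i)))
      ≡⟨ cong (λ b → indicator (b ∧ _) + sum (λ i → indicator (uncut c w (punchIn w i)))) (loopless G w) ⟩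
    sum (λ i → indicator (uncut c w (punchIn w i)))  ∎
    where open ≡-Reasoning

  away : Cut → Fin (suc n) → ℕ
  away c w = sum λ i → sum λ j → indicator (uncut c (punchIn w i) (punchIn w j))

  -- Twice the number of uncut edges, since each is counted at both ends; the quantity that the
  -- local search decreases.
  total : Cut → ℕ
  total c = sum (defect c)

  -- The uncut edges at `w` are counted once in the defect of `w` and, by `uncut-sym`, once more in
  -- the defects of their other ends. `away` does not depend on the side of `w`.
  total-remove : ∀ c w → total c ≡ defect c w + (defect c w + away c w)
  total-remove c w = begin
    total c
      ≡⟨ sum-remove {i = w} (defect c) ⟩
    defect c w + sum (λ i → defect c (punchIn w i))
      ≡⟨ cong (defect c w +_) (sum-cong-≗ λ i → trans (∣tabulate∣ (uncut c (punchIn w i)))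
           (sum-remove {i = w} (indicator ∘ uncut c (punchIn w i)))) ⟩
    defect c w + sum (λ i → indicator (uncut c (punchIn w i) w) + row i)
      ≡⟨ cong (defect c w +_) (∑-distrib-+ (λ i → indicator (uncut c (punchIn w i) w)) row) ⟩
    defect c w + (sum (λ i → indicator (uncut c (punchIn w i) w)) + away c w)
      ≡⟨ cong (λ k → defect c w + (k + away c w)) (trans
           (sum-cong-≗ λ i → cong indicator (uncut-sym c (punchIn w i) w))
           (sym (defect-remove c w))) ⟩
    defect c w + (defect c w + away c w)  ∎
    where
    open ≡-Reasoning
    row : Fin n → ℕ
    row i = sum λ j → indicator (uncut c (punchIn w i) (punchIn w j))

  move : Cut → Fin (suc n) → Cut
  move c w = updateAt c w opposite

  move-≢ : ∀ c w i → move c w (punchIn w i) ≡ c (punchIn w i)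
  move-≢ c w i = updateAt-minimal (punchIn w i) w c (punchInᵢ≢i w i)

  away-move : ∀ c w → away (move c w) w ≡ away c w
  away-move c w = sum-cong-≗ λ i → sum-cong-≗ λ j →
    cong₂ (λ a b → indicator (adj G (punchIn w i) (punchIn w j) ∧ isYes (a ≟ b)))
      (move-≢ c w i) (move-≢ c w j)

  -- A neighbour of `w` is on the side of `w` either before the move or after it, and never both.
  defect-move : ∀ c w → defect c w + defect (move c w) w ≡ degree G w
  defect-move c w = begin
    defect c w + defect (move c w) w
      ≡⟨ cong₂ _+_ (∣tabulate∣ (uncut c w)) (∣tabulate∣ (uncut (move c w) w)) ⟩
    sum (indicator ∘ uncut c w) + sum (indicator ∘ uncut (move c w) w)
      ≡⟨ ∑-distrib-+ (indicator ∘ uncut c w) (indicator ∘ uncut (move c w) w) ⟨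
    sum (λ y → indicator (uncut c w y) + indicator (uncut (move c w) w y))
      ≡⟨ sum-cong-≗ edge ⟩
    sum (indicator ∘ adj G w)
      ≡⟨ ∣tabulate∣ (adj G w) ⟨
    degree G w  ∎
    where
    open ≡-Reasoning
    opposite-cuts : (a b : Fin 2) → indicator (isYes (a ≟ b)) + indicator (isYes (opposite a ≟ b)) ≡ 1
    opposite-cuts 0F 0F = refl
    opposite-cuts 0F 1F = refl
    opposite-cuts 1F 0F = refl
    opposite-cuts 1F 1F = refl
    edge : ∀ y → indicator (uncut c w y) + indicator (uncut (move c w) w y) ≡ indicator (adj G w y)
    edge y with adj G w y in wy
    ... | false = refl
    ... | true rewrite updateAt-updates w {opposite} c
                     | updateAt-minimal y w {opposite} c
                         (λ { refl → contradiction (trans (sym wy) (loopless G w)) λ () })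
      = opposite-cuts (c w) (c y)

  improve : (∀ x → degree G x ≤ 3) → ∀ c w → 2 ≤ defect c w → total (move c w) < total c
  improve deg≤3 c w 2≤d
    rewrite total-remove c w | total-remove (move c w) w | away-move c w =
    ℕ.+-mono-<-≤ d′<d (ℕ.+-monoˡ-≤ (away c w) (ℕ.<⇒≤ d′<d))
    where
    d′<d : defect (move c w) w < defect c w
    -- With `d` and `d′` the defects of `w` before and after the move,
    -- `2 + d′ ≤ d + d′ = degree G w ≤ 3` gives `d′ ≤ 1`, while `2 ≤ d`.
    d′<d = ℕ.≤-trans
      (s≤s (ℕ.+-cancelˡ-≤ 2 _ 1 (ℕ.≤-trans (ℕ.+-monoˡ-≤ _ 2≤d)
        (ℕ.≤-trans (ℕ.≤-reflexive (defect-move c w)) (deg≤3 w))))) 2≤d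

  descend : (∀ x → degree G x ≤ 3) → ∀ c → Acc _<_ (total c) → ∃ λ c → ∀ x → defect c x ≤ 1
  descend deg≤3 c (acc smaller) with any? (λ w → 2 ℕ.≤? defect c w)
  ... | no  none    = c , λ x → ℕ.≮⇒≥ λ 2≤d → none (x , 2≤d)
  ... | yes (w , 2≤d) = descend deg≤3 (move c w) (smaller (improve deg≤3 c w 2≤d))

-- Lovász: moving a vertex with two neighbours on its own side of a cut to the
-- other side makes the cut larger.
Δ≤3⇒paintable : (G : Graph (suc n)) → (∀ x → degree G x ≤ 3) → Paintable 2 G U
Δ≤3⇒paintable G deg≤3 with c , ok ← MaxCut.descend G deg≤3 (λ _ → 0F) (<-wellFounded _) =
  c , λ {x} {y} {z} _ _ _ xy xz cx≡cy cx≡cz →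
    ∣p∣≤1⇒unique (ok x) (MaxCut.uncut-∈ G c xy cx≡cy) (MaxCut.uncut-∈ G c xz cx≡cz)

high-degree : (G : Graph (suc n)) → ¬ Paintable 2 G U → ∃ λ x → 4 ≤ degree G x
high-degree G ¬paint with any? (λ x → 4 ℕ.≤? degree G x)
... | yes high = high
... | no  none = contradiction (Δ≤3⇒paintable G λ x → ℕ.≮⇒≥ λ 4≤d → none (x , 4≤d)) ¬paint

-- Moving a star to the first vertices

extend-injection : (m≤n : m ≤ n) (f : Fin m → Fin n) → Injective _≡_ _≡_ f →
  ∃ λ (π : Permutation′ n) → ∀ i → π ⟨$⟩ʳ inject≤ i m≤n ≡ f i
extend-injection {zero}  m≤n f inj = Perm.id , λ ()
-- Once `f zero` is taken, `punchOut` closes the gap it leaves, so the other values form an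
-- injection into one vertex fewer.
extend-injection {suc m} {suc n} (s≤s m≤n) f inj = Perm.insert zero (f zero) π , λ where
    zero    → refl
    (suc i) → begin
      Perm.insert zero (f zero) π ⟨$⟩ʳ suc (inject≤ i m≤n)  ≡⟨ Perm.insert-punchIn zero (f zero) π (inject≤ i m≤n) ⟩
      punchIn (f zero) (π ⟨$⟩ʳ inject≤ i m≤n)               ≡⟨ cong (punchIn (f zero)) (π≡g i) ⟩
      punchIn (f zero) (g i)                                ≡⟨ punchIn-punchOut (f0≢ i) ⟩
      f (suc i)                                             ∎
  where
  open ≡-Reasoning
  f0≢ : ∀ i → f zero ≢ f (suc i)
  f0≢ i eq = contradiction (inj eq) λ ()
  g : Fin m → Fin n
  g i = punchOut (f0≢ i)
  rest : ∃ λ (π : Permutation′ n) → ∀ i → π ⟨$⟩ʳ inject≤ i m≤n ≡ g i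
  rest = extend-injection m≤n g λ eq → suc-injective (inj (punchOut-injective (f0≢ _) (f0≢ _) eq))
  π : Permutation′ n
  π = proj₁ rest
  π≡g : ∀ i → π ⟨$⟩ʳ inject≤ i m≤n ≡ g i
  π≡g = proj₂ rest

spoke : (G : Graph n) (x : Fin n) {d : ℕ} → d ≤ degree G x → Fin (suc d) → Fin n
spoke G x d≤ zero    = x
spoke G x d≤ (suc i) = element (neighbourhood G x) (inject≤ i d≤)

spoke-adj : (G : Graph n) (x : Fin n) {d : ℕ} (d≤ : d ≤ degree G x) (i : Fin d) →
  Adj G x (spoke G x d≤ (suc i))
spoke-adj G x d≤ i = to ∈-tabulate (element-∈ (neighbourhood G x) _)

-- A leaf equal to the centre would be a loop; the leaves differ because `element` enumerates the
-- neighbourhood without repetition.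
spoke-injective : (G : Graph n) (x : Fin n) {d : ℕ} (d≤ : d ≤ degree G x) →
  Injective _≡_ _≡_ (spoke G x d≤)
spoke-injective G x d≤ {zero}  {zero}  eq = refl
spoke-injective G x d≤ {zero}  {suc j} eq =
  contradiction (subst (Adj G x) (sym eq) (spoke-adj G x d≤ j)) (subst T (loopless G x))
spoke-injective G x d≤ {suc i} {zero}  eq =
  contradiction (subst (Adj G x) eq (spoke-adj G x d≤ i)) (subst T (loopless G x))
spoke-injective G x d≤ {suc i} {suc j} eq = cong suc
  (inject≤-injective d≤ d≤ i j (element-injective (neighbourhood G x) eq))

-- Partially known adjacency matrices

-- `nothing` marks an undecided pair. An assignment to a vector yields a table again and not a
-- growing chain of tests.
State : ℕ → Set
State n = Vec (Vec (Maybe Bool) n) n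

entry : State n → Fin n → Fin n → Maybe Bool
entry σ x y = lookup (lookup σ x) y

infix 4 _⊨_

_⊨_ : Graph n → State n → Set
G ⊨ σ = ∀ x y {b} → entry σ x y ≡ just b → adj G x y ≡ b

-- The diagonal has to be decided: `Splits` also ranges over `y = x`, where `x` must count as its
-- own non-neighbour.
loopsOnly : State n
loopsOnly = tabulate λ x → tabulate λ y → if does (x ≟ y) then just false else nothing

⊨-loopsOnly : (G : Graph n) → G ⊨ loopsOnly
⊨-loopsOnly G x y eq
  rewrite lookup∘tabulate (λ x → tabulate λ y → if does (x ≟ y) then just false else nothing) x
        | lookup∘tabulate (λ y → if does (x ≟ y) then just false else nothing) y
  with yes refl ← x ≟ y | refl ← eq = loopless G x

put : Bool → Fin n → Fin n → State n → State n
put b x y σ = σ [ x ]%= (_[ y ]≔ just b)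

⊨-put : (G : Graph n) (σ : State n) {b : Bool} {x y : Fin n} →
  adj G x y ≡ b → G ⊨ σ → G ⊨ put b x y σ
⊨-put G σ {b} {x} {y} xy≡b G⊨σ i j eq with i ≟ x
... | no i≢x rewrite lookup∘updateAt′ i x {_[ y ]≔ just b} i≢x σ = G⊨σ i j eq
... | yes refl rewrite lookup∘updateAt x {_[ y ]≔ just b} σ with j ≟ y
...   | no j≢y rewrite lookup∘update′ j≢y (lookup σ x) (just b) = G⊨σ i j eq
...   | yes refl rewrite lookup∘update y (lookup σ x) (just b) with refl ← eq = xy≡b

assign : Bool → Fin n → Fin n → State n → State n
assign b x y = put b x y ∘ put b y x

⊨-assign : (G : Graph n) (σ : State n) {b : Bool} {x y : Fin n} →
  adj G x y ≡ b → G ⊨ σ → G ⊨ assign b x y σ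
⊨-assign G σ {x = x} {y} xy≡b = ⊨-put G (put _ y x σ) xy≡b ∘ ⊨-put G σ (trans (adj-sym G y x) xy≡b)

_≟ₘ_ : (p q : Maybe Bool) → Dec (p ≡ q)
_≟ₘ_ = Maybe.≡-dec Bool._≟_

-- A known non-edge may come from a common neighbour, the graphs being triangle-free.
Known : Bool → State n → Fin n → Fin n → Set
Known true  σ x y = entry σ x y ≡ just true
Known false σ x y =
  entry σ x y ≡ just false ⊎ ∃ λ z → entry σ x z ≡ just true × entry σ z y ≡ just true

known? : (b : Bool) (σ : State n) (x y : Fin n) → Dec (Known b σ x y)
known? true  σ x y = entry σ x y ≟ₘ just true
known? false σ x y = (entry σ x y ≟ₘ just false) ⊎-dec
  any? λ z → (entry σ x z ≟ₘ just true) ×-dec (entry σ z y ≟ₘ just true)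

known⇒adj : (G : Graph n) (σ : State n) → TriangleFree G → G ⊨ σ →
  (b : Bool) {x y : Fin n} → Known b σ x y → adj G x y ≡ b
known⇒adj G σ tf G⊨σ true  eq        = G⊨σ _ _ eq
known⇒adj G σ tf G⊨σ false (inj₁ eq) = G⊨σ _ _ eq
known⇒adj G σ tf G⊨σ false {x} {y} (inj₂ (z , xz , zy)) with adj G x y in xy
... | false = refl
... | true  = contradiction
  (x , z , y , from T-≡ (G⊨σ x z xz) , from T-≡ (G⊨σ z y zy) , from T-≡ xy) tf

-- The defect bound has to hold in every triangle-free graph compatible with `σ`, so each pair not
-- known to be a non-edge counts as an edge: `x` may have at most one such partner `y` in its colour
-- class.
Splits : State n → Pred (Fin n) 0ℓ → (Fin n → Fin m) → Set
Splits σ P c = ∀ x → P x → ∀ y → P y × c x ≡ c y →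
  Known false σ x y ⊎ (∀ z → P z × c x ≡ c z → y ≡ z ⊎ Known false σ x z)

splits? : (σ : State n) {P : Pred (Fin n) 0ℓ} → Decidable P → (c : Fin n → Fin m) →
  Dec (Splits σ P c)
splits? σ P? c = all? λ x → P? x →-dec all? λ y → (P? y ×-dec c x ≟ c y) →-dec
  (known? false σ x y ⊎-dec
    all? λ z → (P? z ×-dec c x ≟ c z) →-dec (y ≟ z ⊎-dec known? false σ x z))

splits⇒paintable : (G : Graph n) (σ : State n) → TriangleFree G → G ⊨ σ →
  {P : Pred (Fin n) 0ℓ} {c : Fin n → Fin m} → Splits σ P c → Paintable m G P
splits⇒paintable G σ tf G⊨σ {P} {c} splits = c , ok
  where
  absurd : ∀ {x y} {A : Set} → Adj G x y → Known false σ x y → A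
  absurd xy known = contradiction (trans (sym (to T-≡ xy)) (known⇒adj G σ tf G⊨σ false known)) λ ()
  ok : OneDefective G P c
  ok Px Py Pz xy xz cx≡cy cx≡cz with splits _ Px _ (Py , cx≡cy)
  ... | inj₁ known = absurd xy known
  ... | inj₂ rest  = [ id , absurd xz ] (rest _ (Pz , cx≡cz))

allVec? : {P : Pred (Vec (Fin m) n) 0ℓ} → Decidable P → Dec (∀ v → P v)
allVec? {n = zero}  P? = map′ (λ { p [] → p }) (λ f → f []) (P? [])
allVec? {n = suc n} P? = map′ (λ { f (i ∷ v) → f i v }) (λ f i v → f (i ∷ v))
  (all? λ i → allVec? λ v → P? (i ∷ v))

-- Every colouring has a monochromatic path `y`, `x`, `z` of known edges. Colourings are vectors
-- here because those can be enumerated without function extensionality; `tabulate` translates back.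
Unpaintable : ℕ → State n → Pred (Fin n) 0ℓ → Set
Unpaintable {n} m σ P = (c : Vec (Fin m) n) → ∃ λ x → ∃ λ y →
  (entry σ x y ≡ just true × lookup c x ≡ lookup c y × P x × P y) ×
  ∃ λ z → entry σ x z ≡ just true × lookup c x ≡ lookup c z × P z × y ≢ z

unpaintable? : (m : ℕ) (σ : State n) {P : Pred (Fin n) 0ℓ} → Decidable P → Dec (Unpaintable m σ P)
unpaintable? m σ P? = allVec? λ c → any? λ x → any? λ y →
  ((entry σ x y ≟ₘ just true) ×-dec (lookup c x ≟ lookup c y) ×-dec P? x ×-dec P? y) ×-dec
  any? λ z → (entry σ x z ≟ₘ just true) ×-dec (lookup c x ≟ lookup c z) ×-dec P? z ×-dec ¬? (y ≟ z)

unpaintable⇒¬paintable : (G : Graph n) (σ : State n) {P : Pred (Fin n) 0ℓ} → G ⊨ σ →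
  Unpaintable m σ P → ¬ Paintable m G P
unpaintable⇒¬paintable G σ G⊨σ blocked (c , ok)
  with x , y , (xy , cx≡cy , Px , Py) , z , xz , cx≡cz , Pz , y≢z ← blocked (tabulate c)
  rewrite lookup∘tabulate c x | lookup∘tabulate c y | lookup∘tabulate c z =
  y≢z (ok Px Py Pz (from T-≡ (G⊨σ x y xy)) (from T-≡ (G⊨σ x z xz)) cx≡cy cx≡cz)

relabel : Permutation m n → Graph n → Graph m
relabel π G = record
  { adj      = λ x y → adj G (π ⟨$⟩ʳ x) (π ⟨$⟩ʳ y)
  ; adj-sym  = λ x y → adj-sym G (π ⟨$⟩ʳ x) (π ⟨$⟩ʳ y)
  ; loopless = λ x → loopless G (π ⟨$⟩ʳ x)
  }

relabel-≅ : (π : Permutation m n) (G : Graph n) → relabel π G ≅ G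
relabel-≅ π G = record { bijection = π ; preserves = λ _ _ → refl }

Embeds : State m → (Fin m → Fin n) → State n → Set
Embeds τ f σ = ∀ x y → MaybeAll.All (λ b → Known b σ (f x) (f y)) (entry τ x y)

embeds? : (τ : State m) (f : Fin m → Fin n) (σ : State n) → Dec (Embeds τ f σ)
embeds? τ f σ = all? λ x → all? λ y → MaybeAll.dec (λ b → known? b σ (f x) (f y)) (entry τ x y)

embeds⇒⊨ : (G : Graph n) (σ : State n) (τ : State m) (π : Permutation m n) →
  TriangleFree G → G ⊨ σ → Embeds τ (π ⟨$⟩ʳ_) σ → relabel π G ⊨ τ
embeds⇒⊨ G σ τ π tf G⊨σ embeds x y {b} eq =
  known⇒adj G σ tf G⊨σ b (MaybeAll.drop-just (subst (MaybeAll.All _) eq (embeds x y)))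

complete : Graph n → State n
complete G = tabulate λ x → tabulate λ y → just (adj G x y)

entry-complete : (G : Graph n) (x y : Fin n) → entry (complete G) x y ≡ just (adj G x y)
entry-complete G x y = trans
  (cong (λ row → lookup row y) (lookup∘tabulate (λ x → tabulate λ y → just (adj G x y)) x))
  (lookup∘tabulate (λ y → just (adj G x y)) y)

⊨-complete : (G : Graph n) → G ⊨ complete G
⊨-complete G x y eq = just-injective (trans (sym (entry-complete G x y)) eq)

edges : List (Fin n × Fin n) → State n
edges = foldr (uncurry (assign true)) loopsOnly

⊨-edges : (G : Graph n) (es : List (Fin n × Fin n)) → All (uncurry (Adj G)) es → G ⊨ edges es
⊨-edges G []       []        = ⊨-loopsOnly G
⊨-edges G (_ ∷ es) (xy ∷ ok) = ⊨-assign G (edges es) (to T-≡ xy) (⊨-edges G es ok)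

-- The case distinction

Forces : State 10 → Set
Forces σ = (G : Graph 10) → TriangleFree G → Minimal G → G ⊨ σ → G ≅ G₅

forces-branch : (σ : State 10) (x y : Fin 10) →
  Forces (assign true x y σ) → Forces (assign false x y σ) → Forces σ
forces-branch σ x y f g G tf min G⊨σ with adj G x y in eq
... | true  = f G tf min (⊨-assign G σ eq G⊨σ)
... | false = g G tf min (⊨-assign G σ eq G⊨σ)

forces-colour : (σ : State 10) (c : Fin 10 → Fin 2) → Splits σ U c → Forces σ
forces-colour σ c splits G tf (¬paint , _) G⊨σ =
  contradiction (splits⇒paintable G σ tf G⊨σ splits) ¬paint

-- A graph satisfying `σ`, renamed along `π`, satisfies `τ`, and the hypotheses and the conclusion
-- of `Forces` survive renaming. Undecided entries of `τ` impose nothing, so `τ` may say far less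
-- than `σ`.
forces-embed : (σ τ : State 10) (π : Permutation′ 10) →
  Embeds τ (π ⟨$⟩ʳ_) σ → Forces τ → Forces σ
forces-embed σ τ π embeds f G tf min G⊨σ =
  ≅-trans (≅-sym πG≅G) (f (relabel π G) (≅-triangleFree πG≅G tf) (≅-minimal πG≅G min)
    (embeds⇒⊨ G σ τ π tf G⊨σ embeds))
  where
  πG≅G : relabel π G ≅ G
  πG≅G = relabel-≅ π G

forces-unpaintable : (σ : State 10) (w : Fin 10) → Unpaintable 2 σ (_≢ w) → Forces σ
forces-unpaintable σ w unpaintable G tf (_ , paint) G⊨σ =
  contradiction (paint w) (unpaintable⇒¬paintable G σ G⊨σ unpaintable)

-- In colour k, digit i of the decimal number k, counted from the right, is the colour
-- of the vertex i.  In embed k, it is the vertex with which i is transposed, for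
-- i = 0, …, 9 in this order, to give a map from a state settled before.
data Tree : Set where
  branch : Fin 10 → Fin 10 → Tree → Tree → Tree
  colour embed : ℕ → Tree

digit : (b : ℕ) .{{_ : NonZero b}} → ℕ → Fin 10 → Fin b
digit b k i = (k / 10 ^ toℕ i) {{ℕ.m^n≢0 10 (toℕ i)}} mod b

colouring : ℕ → Vec (Fin 2) 10
colouring k = tabulate (digit 2 k)

-- A factorisation as in the Fisher-Yates shuffle, with the transposition of `0` acting first. Any
-- digits give a bijection, and `9876543210` is the identity.
transpositions : ℕ → Permutation′ 10
transpositions k = foldr (λ i π → transpose i (digit 10 k i) ∘ₚ π) Perm.id (allFin 10)

-- The first branch settles the graphs with the edge {x , y}, so the second one may assume
-- that no isomorphic copy of the first state occurs.
check : List (∃ Forces) → (σ : State 10) → Tree → Maybe (Forces σ)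
check Γ σ (branch x y s t) =
  check Γ (assign true x y σ) s >>= λ f →
  check ((assign true x y σ , f) ∷ Γ) (assign false x y σ) t >>= λ g →
  just (forces-branch σ x y f g)
check Γ σ (colour k) =
  Maybe.map (forces-colour σ c) (dec⇒maybe (splits? σ U? c))
  where
  c : Fin 10 → Fin 2
  c = lookup (colouring k)
check Γ σ (embed k) = go Γ
  where
  π : Permutation′ 10
  π = transpositions k
  go : List (∃ Forces) → Maybe (Forces σ)
  go [] = nothing
  go ((τ , f) ∷ Γ) =
    Maybe.map (λ e → forces-embed σ τ π e f) (dec⇒maybe (embeds? τ (π ⟨$⟩ʳ_) σ)) <∣> go Γ

-- The four triangle-free graphs of order 9 without a 2-colouring of defect at most 1,
-- together with the isolated vertex 9.
sporadic-edges : Vec (List (Fin 10 × Fin 10)) 4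
sporadic-edges =
    ( (0F , 5F) ∷ (0F , 6F) ∷ (0F , 7F) ∷ (1F , 5F) ∷ (1F , 6F) ∷ (1F , 7F) ∷ (2F , 7F) ∷ (2F , 8F) ∷
      (3F , 7F) ∷ (3F , 8F) ∷ (4F , 7F) ∷ (4F , 8F) ∷ (5F , 8F) ∷ (6F , 8F) ∷ [] )
  ∷ ( (0F , 4F) ∷ (0F , 5F) ∷ (0F , 7F) ∷ (1F , 4F) ∷ (1F , 5F) ∷ (1F , 7F) ∷ (2F , 6F) ∷ (2F , 7F) ∷
      (2F , 8F) ∷ (3F , 6F) ∷ (3F , 7F) ∷ (3F , 8F) ∷ (4F , 8F) ∷ (5F , 8F) ∷ [] )
  ∷ ( (0F , 4F) ∷ (0F , 5F) ∷ (0F , 6F) ∷ (0F , 7F) ∷ (1F , 4F) ∷ (1F , 5F) ∷ (1F , 7F) ∷ (2F , 6F) ∷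
      (2F , 7F) ∷ (2F , 8F) ∷ (3F , 6F) ∷ (3F , 7F) ∷ (3F , 8F) ∷ (4F , 8F) ∷ (5F , 8F) ∷ [] )
  ∷ ( (0F , 4F) ∷ (0F , 5F) ∷ (0F , 6F) ∷ (0F , 7F) ∷ (1F , 4F) ∷ (1F , 5F) ∷ (1F , 6F) ∷ (1F , 7F) ∷
      (2F , 6F) ∷ (2F , 7F) ∷ (2F , 8F) ∷ (3F , 6F) ∷ (3F , 7F) ∷ (3F , 8F) ∷ (4F , 8F) ∷ (5F , 8F) ∷ [] )
  ∷ []

abstract
  forces-sporadic : ∀ i → Forces (edges (lookup sporadic-edges i))
  forces-sporadic i = forces-unpaintable (edges (lookup sporadic-edges i)) 9F
    (from-yes (all? λ i → unpaintable? 2 (edges (lookup sporadic-edges i)) λ x → ¬? (x ≟ 9F)) i)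

sporadic : List (∃ Forces)
sporadic = map (λ i → edges (lookup sporadic-edges i) , forces-sporadic i) (allFin 4)

G₅-state : State 10
G₅-state = complete G₅

forces-G₅-state : Forces G₅-state
forces-G₅-state G _ _ G⊨ = record
  { bijection = Perm.id
  ; preserves = λ x y → G⊨ x y (entry-complete G₅ x y)
  }

-- Only two non-adjacent pairs of `G₅` lack a common neighbour: `u₄`, `z₂` and `u₅`, `z₁`. If the
-- first is an edge, the second sporadic graph appears after deleting `u₅`; if the second is an
-- edge, it appears after deleting `u₄`. Otherwise the graph is `G₅`.
G₅-tree : Tree
G₅-tree =
  branch 5F 8F (embed 9979673267) (branch 6F 7F (embed 9976973267) (embed 9876543210))

abstract
  forces-G₅ : Forces (edges G₅-edges)
  forces-G₅ =
    -- The final argument has a type that evaluates to the unit type exactly when `check` succeeds.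
    to-witness-T (check ((G₅-state , forces-G₅-state) ∷ sporadic) (edges G₅-edges) G₅-tree) _

star-edges : List (Fin 10 × Fin 10)
star-edges = (0F , 1F) ∷ (0F , 2F) ∷ (0F , 3F) ∷ (0F , 4F) ∷ []

-- The neighbours of `0` are pairwise non-adjacent and can form one colour class, with `0` and its
-- non-neighbours as the other. This succeeds unless three non-neighbours span a path, which leaves
-- only degrees up to 6. The first subtree settles every graph with a vertex of degree at least 5,
-- so a fifth neighbour found later, at `0` or elsewhere, leads back to it by `embed`.
star-tree : Tree
star-tree =
  branch 0F 5F (branch 0F 6F (branch 0F 7F (branch 0F 9F (colour 0100000001) (branch 0F 8F
  (colour 0111111110) (colour 0011111110))) (branch 0F 9F (embed 9896543210) (branch 0F 8F
  (colour 0101111110) (branch 7F 9F (branch 7F 8F (branch 2F 7F (branch 5F 9F (branch 4F 7F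
  (branch 1F 9F (branch 3F 7F (branch 1F 8F (branch 5F 8F (embed 9889743277) (branch 6F 9F
  (branch 6F 8F (embed 9987943277) (colour 0101111110)) (colour 0010000011))) (branch 5F 8F
  (embed 9876543250) (colour 0101111110))) (branch 6F 7F (embed 9876566210) (colour 0011101110)))
  (branch 3F 9F (embed 9876543230) (branch 6F 9F (embed 9876646230) (colour 0110000001))))
  (branch 6F 7F (embed 9876563210) (branch 3F 7F (embed 9876544210) (colour 0011111010))))
  (branch 1F 9F (embed 9876555250) (branch 6F 9F (embed 9876643210) (branch 3F 9F
  (embed 9876555210) (colour 0110000001))))) (branch 5F 7F (embed 9876554310) (branch 4F 7F
  (embed 9876544310) (branch 1F 7F (embed 9876543220) (branch 6F 7F (colour 0010111110)
  (colour 0011111110)))))) (branch 8F 9F (embed 9986543210) (colour 0001111110))) (branch 8F 9F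
  (embed 9886543210) (colour 0001111110)))))) (branch 0F 9F (embed 9889543210) (branch 0F 7F
  (embed 9899543210) (branch 0F 8F (embed 9989543210) (branch 6F 9F (branch 6F 7F (branch 1F 6F
  (branch 3F 6F (branch 6F 8F (branch 5F 6F (embed 9879878819) (branch 2F 6F (embed 9889783219)
  (branch 4F 6F (embed 9889788819) (colour 0001110110)))) (branch 2F 9F (branch 5F 9F
  (branch 8F 9F (branch 4F 9F (branch 1F 8F (branch 3F 8F (embed 9997777277) (colour 0101111100))
  (colour 0101110110)) (branch 5F 7F (branch 2F 7F (branch 4F 6F (embed 9978743727) (branch 3F 8F
  (branch 1F 8F (embed 9999797277) (colour 0101110110)) (colour 0101111100))) (colour 0101100001))
  (colour 0101000101))) (branch 2F 7F (branch 5F 7F (branch 4F 6F (embed 9978743727) (branch 1F 8F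
  (branch 3F 8F (embed 9898793727) (colour 0001110110)) (colour 0001111100))) (branch 4F 7F
  (branch 1F 8F (branch 4F 9F (embed 9876553210) (branch 2F 8F (branch 4F 8F (branch 3F 8F
  (branch 5F 8F (embed 9979653420) (colour 0111100001)) (colour 0001110110)) (colour 0010101110))
  (colour 0101000101))) (colour 0001111100)) (colour 0010111110))) (branch 5F 7F
  (embed 9876543510) (colour 0010111110)))) (branch 4F 9F (embed 9876553210) (branch 2F 8F
  (branch 7F 8F (branch 4F 7F (colour 0101010001) (colour 0010111110)) (colour 0111000001))
  (branch 4F 7F (branch 7F 8F (branch 2F 7F (embed 9896553210) (colour 0101010001))
  (colour 0111000001)) (colour 0101000101))))) (branch 4F 9F (embed 9876543410) (branch 7F 8F
  (branch 2F 7F (embed 9896543210) (branch 4F 7F (embed 9896543410) (branch 5F 7F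
  (colour 0101100001) (colour 0101000001)))) (colour 0111000001))))) (branch 5F 6F
  (embed 9876554210) (branch 2F 6F (embed 9876543310) (branch 4F 6F (embed 9876544210)
  (branch 8F 9F (branch 7F 8F (branch 2F 8F (branch 3F 8F (embed 9878543220) (branch 5F 7F
  (branch 4F 8F (embed 9878544220) (colour 0101111100)) (branch 4F 8F (colour 0101001001)
  (branch 1F 8F (embed 9878543310) (colour 0101111010))))) (branch 3F 8F (embed 9876543310)
  (branch 5F 8F (embed 9876554310) (colour 0101111100)))) (colour 0001111110))
  (colour 0001111110)))))) (branch 5F 6F (embed 9876554320) (branch 2F 6F (embed 9876543220)
  (branch 3F 6F (embed 9876543320) (branch 7F 8F (branch 8F 9F (branch 4F 7F (embed 9977544320)
  (branch 2F 8F (embed 9878543220) (branch 4F 9F (embed 9987544320) (branch 5F 8F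
  (embed 9878554320) (branch 1F 8F (embed 9878543210) (colour 0101101110))))))
  (colour 0001111110)) (colour 0001111110)))))) (branch 7F 9F (embed 9897543210) (branch 6F 8F
  (embed 9886543210) (branch 8F 9F (embed 9987543210) (colour 0000111110))))) (branch 7F 8F
  (embed 9977543210) (branch 8F 9F (embed 9887543210) (branch 6F 7F (embed 9996543210)
  (colour 0000111110))))))))) (branch 0F 8F (embed 9978943210) (branch 0F 9F (embed 9878943210)
  (branch 0F 7F (embed 9998943210) (branch 5F 9F (branch 5F 8F (branch 0F 6F (embed 9889943210)
  (branch 1F 5F (branch 5F 7F (branch 2F 5F (embed 9886978219) (branch 3F 5F (embed 9886978819)
  (branch 4F 5F (embed 9876987819) (branch 6F 7F (branch 6F 9F (branch 4F 6F (branch 2F 6F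
  (branch 3F 6F (embed 9989788889) (branch 4F 8F (branch 3F 7F (branch 3F 9F (branch 2F 8F
  (branch 3F 8F (embed 9988657490) (colour 0101101001)) (colour 0001101001)) (colour 0101100001))
  (colour 0101100001)) (colour 0001101001))) (branch 3F 6F (embed 9876543310)
  (colour 0001111100))) (branch 2F 6F (embed 9876544410) (colour 0001111100))) (branch 6F 8F
  (embed 9976543210) (colour 0000111110))) (branch 6F 8F (embed 9886543210)
  (colour 0000111110)))))) (branch 2F 9F (branch 5F 6F (embed 9877543210) (branch 3F 9F
  (branch 6F 9F (branch 7F 9F (embed 9887878889) (branch 1F 7F (branch 1F 6F (branch 4F 5F
  (branch 2F 8F (branch 3F 8F (branch 4F 7F (embed 9999877727) (branch 4F 6F (embed 9997773277)
  (branch 3F 7F (branch 2F 7F (branch 6F 8F (embed 9879995470) (colour 0000101110))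
  (colour 0011111100)) (colour 0011111100)))) (branch 2F 7F (branch 6F 8F (embed 9876576511)
  (branch 3F 7F (embed 9887978922) (colour 0111101001))) (colour 0011100101))) (branch 3F 7F
  (embed 9886563359) (colour 0011101001))) (branch 6F 8F (branch 4F 6F (embed 9876643210)
  (branch 3F 7F (branch 2F 7F (embed 9979995470) (branch 4F 7F (branch 4F 9F (embed 9979954970)
  (branch 3F 8F (embed 9887968972) (colour 0011100101))) (colour 0011111100))) (branch 2F 7F
  (embed 9876543310) (colour 0011111100)))) (colour 0000111110))) (branch 4F 5F (embed 9886563259)
  (colour 0001111110))) (branch 4F 5F (branch 4F 6F (branch 2F 7F (embed 9878944220) (branch 3F 8F
  (branch 4F 7F (embed 9876543240) (branch 1F 6F (branch 2F 8F (embed 9997773277)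
  (colour 0001101001)) (colour 0001101110))) (colour 0011100101))) (colour 0001111100))
  (colour 0001111100)))) (branch 7F 9F (embed 9877543210) (branch 3F 8F (branch 2F 8F
  (branch 7F 8F (embed 9977543210) (branch 6F 8F (embed 9976543210) (branch 4F 5F (branch 3F 7F
  (embed 9877549815) (branch 2F 7F (embed 9977548915) (branch 4F 6F (branch 1F 6F
  (embed 9996877727) (branch 4F 7F (branch 1F 7F (embed 9999877727) (colour 0000111100))
  (colour 0010111100))) (branch 1F 7F (branch 4F 7F (embed 9999877727) (colour 0000101110))
  (colour 0010101110))))) (colour 0000111110)))) (branch 4F 8F (branch 6F 8F (embed 9976544410)
  (branch 7F 8F (embed 9977544410) (colour 0000111110))) (colour 0100011110))) (branch 2F 8F
  (embed 9876543310) (colour 0100011110))))) (branch 4F 9F (embed 9876544210) (branch 2F 8F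
  (branch 7F 8F (branch 3F 8F (embed 9976543210) (branch 2F 6F (branch 4F 8F (embed 9976544210)
  (branch 7F 9F (branch 1F 6F (branch 3F 6F (branch 3F 5F (embed 9999895740) (branch 1F 7F
  (embed 9976896872) (branch 4F 6F (branch 4F 5F (embed 9888859740) (branch 4F 7F (branch 3F 7F
  (embed 9889654790) (colour 0010111110)) (colour 0010111110))) (colour 0010101110))))
  (branch 4F 6F (embed 9876544210) (colour 0010100101))) (branch 3F 6F (branch 3F 5F
  (embed 9986943220) (branch 4F 5F (embed 9986944220) (branch 3F 7F (embed 9876743230)
  (colour 0010111100)))) (colour 0010100101))) (colour 0100011110))) (colour 0011100101)))
  (branch 6F 8F (embed 9877543210) (colour 0111100001))) (branch 4F 8F (branch 3F 8F
  (embed 9976544410) (colour 0011100001)) (colour 0011100001)))))) (branch 4F 8F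
  (embed 9976544310) (branch 3F 8F (embed 9976543310) (branch 5F 6F (embed 9877543210)
  (branch 4F 9F (embed 9877544310) (colour 0011100001))))))) (branch 4F 5F (embed 9876544320)
  (branch 2F 5F (embed 9876543220) (branch 6F 8F (branch 7F 8F (branch 3F 5F (embed 9876543320)
  (branch 7F 9F (branch 3F 7F (embed 9877643320) (branch 1F 7F (embed 9877643210) (branch 2F 7F
  (embed 9877643220) (branch 6F 9F (branch 4F 9F (embed 9999844320) (branch 4F 8F
  (embed 9899844320) (branch 2F 6F (embed 9876643220) (branch 1F 6F (embed 9876643210)
  (colour 0011101110))))) (colour 0010111110))))) (branch 1F 6F (branch 6F 9F (embed 9876643210)
  (branch 4F 8F (embed 9899844320) (branch 3F 8F (embed 9899843320) (colour 0100011110))))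
  (branch 4F 6F (embed 9876544320) (branch 3F 6F (embed 9876543320) (colour 0001111110))))))
  (branch 6F 9F (branch 3F 6F (embed 9876643320) (branch 4F 6F (embed 9876644320) (branch 1F 6F
  (embed 9876643210) (colour 0001111110)))) (branch 6F 7F (branch 3F 6F (embed 9986643320)
  (branch 4F 6F (embed 9986644320) (branch 2F 6F (embed 9986643220) (colour 0001111110))))
  (colour 0000111110)))) (branch 7F 9F (embed 9977543210) (branch 6F 9F (embed 9976543210)
  (branch 7F 8F (embed 9877543210) (colour 0000111110))))))))) (branch 7F 9F (embed 9996843210)
  (branch 8F 9F (embed 9976843210) (branch 5F 7F (embed 9886543210) (branch 1F 6F (branch 3F 6F
  (branch 5F 6F (embed 9878543210) (branch 6F 9F (embed 9979843210) (branch 6F 7F (branch 6F 8F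
  (embed 9987743210) (branch 7F 8F (embed 9978743210) (colour 0000011110))) (branch 6F 8F
  (embed 9886543210) (colour 0000011110))))) (branch 4F 6F (embed 9876544210) (branch 2F 6F
  (embed 9876543310) (colour 0001011110)))) (branch 3F 6F (embed 9876543320) (branch 4F 6F
  (embed 9876544320) (colour 0001011110)))))))) (branch 7F 8F (embed 9976743210) (branch 5F 8F
  (embed 9976543210) (branch 7F 9F (embed 9876743210) (branch 1F 6F (branch 6F 9F
  (embed 9887743210) (branch 6F 7F (embed 9897743210) (branch 6F 8F (embed 9987743210)
  (branch 5F 6F (embed 9879543210) (colour 0000011110))))) (branch 2F 6F (embed 9876543220)
  (branch 3F 6F (embed 9876543320) (colour 0001011110)))))))))))

abstract
  forces-star : Forces (edges star-edges)
  forces-star =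
    to-witness-T (check ((edges G₅-edges , forces-G₅) ∷ sporadic) (edges star-edges) star-tree) _

degree≥4⇒≅G₅ : (G : Graph 10) → TriangleFree G → Minimal G → ∀ x → 4 ≤ degree G x → G ≅ G₅
degree≥4⇒≅G₅ G tf min x 4≤d =
  ≅-trans (≅-sym πG≅G) (forces-star (relabel π G)
    (≅-triangleFree πG≅G tf) (≅-minimal πG≅G min)
    (⊨-edges (relabel π G) star-edges (ray 0F ∷ ray 1F ∷ ray 2F ∷ ray 3F ∷ [])))
  where
  extension : ∃ λ (π : Permutation′ 10) → ∀ i → π ⟨$⟩ʳ inject≤ i (ℕ.m≤m+n 5 5) ≡ spoke G x 4≤d i
  extension = extend-injection (ℕ.m≤m+n 5 5) (spoke G x 4≤d) (spoke-injective G x 4≤d)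
  π : Permutation′ 10
  π = proj₁ extension
  πG≅G : relabel π G ≅ G
  πG≅G = relabel-≅ π G
  ray : (i : Fin 4) → Adj (relabel π G) 0F (suc (inject≤ i (ℕ.m≤m+n 4 5)))
  ray i = subst₂ (Adj G) (sym (proj₂ extension 0F)) (sym (proj₂ extension (suc i))) (spoke-adj G x 4≤d i)

minimal⇒≅G₅ : (G : Graph 10) → TriangleFree G → Minimal G → G ≅ G₅
minimal⇒≅G₅ G tf min = uncurry (degree≥4⇒≅G₅ G tf min) (high-degree G (proj₁ min))

-- Criticality of `G₅` and the equivalence

G₅-colourings : Vec ℕ 10
G₅-colourings =
  -- Entry `w` colours `G₅` without `w`, in the notation of `colour`; its digit at `w` is arbitrary.
  0011011100 ∷ 0011011100 ∷ 0110000011 ∷ 0110000011 ∷ 0011101100 ∷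
  0011011100 ∷ 0100111100 ∷ 0001111100 ∷ 0001111100 ∷ 0001111100 ∷ []

abstract
  unpaintable-G₅ : ¬ Paintable 2 G₅ U
  unpaintable-G₅ = unpaintable⇒¬paintable G₅ (edges G₅-edges)
    (⊨-edges G₅ G₅-edges (from-yes (All.all? (λ (x , y) → T? (adj G₅ x y)) G₅-edges)))
    (from-yes (unpaintable? 2 (edges G₅-edges) U?))

  split-G₅ : ∀ w → Splits G₅-state (_≢ w) (lookup (colouring (lookup G₅-colourings w)))
  split-G₅ = from-yes (all? λ w →
    splits? G₅-state (λ x → ¬? (x ≟ w)) (lookup (colouring (lookup G₅-colourings w))))

minimal-G₅ : TriangleFree G₅ → Minimal G₅
minimal-G₅ tf = unpaintable-G₅ , λ w → splits⇒paintable G₅ G₅-state tf (⊨-complete G₅) (split-G₅ w)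

theorem3p3 : (G : Graph 10) → TriangleFree G → (Critical 3 1 G ⇔ G ≅ G₅)
theorem3p3 G tf = mk⇔
  (minimal⇒≅G₅ G tf ∘ to (critical⇔minimal G))
  (λ G≅G₅ → from (critical⇔minimal G)
    -- `G₅` inherits triangle-freeness from `G` through the isomorphism.
    (≅-minimal G≅G₅ (minimal-G₅ (≅-triangleFree (≅-sym G≅G₅) tf))))
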